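{- Let $k,n,q$ be positive integers and fix page functions $g_1,\dots,g_n:\Omega_{k,q}\to[q]$ on $B_{k,n}$. These page functions can be completed by spine functions to a winning $q$-color strategy on $B_{k,n}$ if and only if they guard every non-coverable configuration $P\subseteq\Omega_{k,q}$.
   Context: The book graph $B_{k,n}=K_k\vee\overline{K_n}$ has $k$ mutually adjacent vertices (spines) and $n$ pairwise nonadjacent vertices (pages), every page adjacent to every spine. Let $[q]=\{0,\dots,q-1\}$ and $\Omega_{k,q}=\{\boldsymbol{x}\in[q]^k: x_i\ne x_j \text{ whenever } i\neq j\}$. A proper $q$-coloring of $B_{k,n}$ is a pair $(\boldsymbol{x},\boldsymbol{z})\in\Omega_{k,q}\times[q]^n$ (spine colors, page colors) with $z_j\notin\{x_1,\dots,x_k\}$ for all $j$. In the proper hat-guessing game with $q$ colors on $B_{k,n}$, page $j$ uses a guess function $g_j:\Omega_{k,q}\to[q]$ of the spine tuple, and spine $i$ uses a $[q]$-valued guess function of $(\boldsymbol{x}_{ -i},\boldsymbol{z})$, where $\boldsymbol{x}_{ -i}$ is $\boldsymbol{x}$ with coordinate $i$ deleted. A strategy is winning if for every proper $q$-coloring at least one vertex's guess equals its own color. A configuration is a subset $P\subseteq\Omega_{k,q}$. With $\pi_i(\boldsymbol{x})=\boldsymbol{x}_{ -i}$, a set $A\subseteq\Omega_{k,q}$ is $i$-saturated if $\pi_i$ restricted to $A$ is injective; $P$ is coverable if it has a partition $P=P_1\,\dot\cup\cdots\dot\cup\,P_k$ (parts may be empty) with $P_i$ being $i$-saturated for every $i$.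 Let $\mathrm{supp}(P)=\bigcup_{\boldsymbol{x}\in P}\{x_1,\dots,x_k\}$ and $g_j(P)=\{g_j(\boldsymbol{x}):\boldsymbol{x}\in P\}$. Page $j$ guards $P$ if $[q]\setminus\mathrm{supp}(P)\subseteq g_j(P)$. The family of pages guards $P$ if at least one page guards it. -}

module Defs where

open import Data.Bool.Base using (Bool; T)
open import Data.Fin.Base using (Fin)
open import Data.Nat.Base using (ℕ; zero; suc; pred)
open import Data.Product.Base using (∃; ∃-syntax; _×_)
open import Data.Refinement.Base using (Refinement-syntax; value)
open import Data.Sum.Base using (_⊎_)
open import Data.Vec.Base using (Vec; lookup; removeAt)
open import Level using (0ℓ)
open import Relation.Binary.PropositionalEquality using (_≡_; _≢_)
open import Relation.Unary using (Pred; ∁; ⋃; _⊆_; _≐_; _⊥_)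

private
  variable
    k n q : ℕ

Distinct : Vec (Fin q) k → Set
Distinct x = ∀ {i j} → i ≢ j → lookup x i ≢ lookup x j

-- The distinctness proof is held irrelevantly, so that two elements of Ω with
-- the same coordinates are propositionally equal, and hence indistinguishable
-- to functions on Ω.
Ω : ℕ → ℕ → Set
Ω k q = [ x ∈ Vec (Fin q) k ∣ Distinct x ]

-- x₋ᵢ.  The case split only serves to expose the shape suc m of the length
-- required by removeAt; there is no i when k = 0.
π : Fin k → Ω k q → Vec (Fin q) (pred k)
π {suc _} i x = removeAt (value x) i

-- The game.  A q-colouring of the book graph is a pair (x , z) of spine
-- colours and page colours; distinctness of the spine colours is part of Ω.

Proper : Ω k q → Vec (Fin q) n → Set
Proper x z = ∀ j i → lookup z j ≢ lookup (value x) i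

PageFunction : ℕ → ℕ → Set
PageFunction k q = Ω k q → Fin q

-- The arguments are x₋ᵢ and z.  Functions are total on all of
-- [q]^(k-1) × [q]^n; the values on tuples that do not come from a proper
-- colouring play no role.
SpineFunction : ℕ → ℕ → ℕ → Set
SpineFunction k n q = Vec (Fin q) (pred k) → Vec (Fin q) n → Fin q

Winning : (Fin n → PageFunction k q) → (Fin k → SpineFunction k n q) → Set
Winning {n} {k} {q} g h =
  (x : Ω k q) (z : Vec (Fin q) n) → Proper x z →
    (∃[ j ] g j x ≡ lookup z j) ⊎ (∃[ i ] h i (π i x) z ≡ lookup (value x) i)

-- Subsets of the finite set Ω, given by their characteristic functions.
Configuration : ℕ → ℕ → Set
Configuration k q = Ω k q → Bool

⟦_⟧ : Configuration k q → Pred (Ω k q) 0ℓ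
⟦ P ⟧ x = T (P x)

Saturated : Fin k → Configuration k q → Set
Saturated i A = ∀ {x y} → ⟦ A ⟧ x → ⟦ A ⟧ y → π i x ≡ π i y → x ≡ y

Coverable : Configuration k q → Set
Coverable {k} {q} P =
  ∃ λ (part : Fin k → Configuration k q) →
    (⟦ P ⟧ ≐ ⋃ (Fin k) (λ i → ⟦ part i ⟧)) ×
    (∀ {i j} → i ≢ j → ⟦ part i ⟧ ⊥ ⟦ part j ⟧) ×
    (∀ i → Saturated i (part i))

supp : Configuration k q → Pred (Fin q) 0ℓ
supp P c = ∃[ x ] ⟦ P ⟧ x × ∃[ i ] lookup (value x) i ≡ c

image : PageFunction k q → Configuration k q → Pred (Fin q) 0ℓ
image g P c = ∃[ x ] ⟦ P ⟧ x × g x ≡ c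

PageGuards : PageFunction k q → Configuration k q → Set
PageGuards g P = ∁ (supp P) ⊆ image g P

Guards : (Fin n → PageFunction k q) → Configuration k q → Set
Guards g P = ∃[ j ] PageGuards (g j) P

{-# OPTIONS --safe #-}

-- Once the page colours z are fixed, the spines have to guess correctly on the
-- configuration of those spine tuples that are properly coloured by z and on
-- which every page errs.  Spine functions of x₋ᵢ guessing correctly somewhere on
-- every tuple of a configuration amount to a covering of it: the tuples on which
-- spine i is right form an i-saturated set.  A configuration P lies in the one
-- attached to some z exactly when, for every j, a colour zⱼ outside supp(P) and
-- gⱼ(P) exists, that is, when no page guards P.
module Submission where

open import Defs
open import Data.Bool.Properties using (T?; T-irrelevant)
open import Data.Fin.Base using (Fin; zero; finToFun; funToFin)
open import Data.Fin.Properties using (_≟_; all?; any?; ¬∀⟶∃¬; finToFun-funToFin)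
open import Data.Irrelevant using ([_])
open import Data.Nat.Base using (ℕ; suc; pred; _^_; NonZero)
open import Data.Product.Base using (∃; ∃-syntax; Σ; _×_; _,_; proj₁; proj₂)
open import Data.Refinement.Base using (value; _,_)
open import Data.Refinement.Properties using (value-injective)
open import Data.Sum.Base using (inj₁; inj₂)
open import Data.Vec.Base using (Vec; lookup; tabulate; insertAt)
open import Data.Vec.Properties
  using (tabulate-cong; tabulate∘lookup; lookup∘tabulate; insertAt-removeAt; ≡-dec)
open import Function.Base using (_∘_; case_of_)
open import Function.Bundles using (_⇔_; mk⇔)
open import Relation.Binary.PropositionalEquality
  using (_≡_; _≢_; refl; sym; trans; cong; cong₂; subst; module ≡-Reasoning)
open import Relation.Nullary.Decidable
  using (Dec; yes; no; map′; ¬?; _×-dec_; _→-dec_; decidable-stable; isYes; toWitness; fromWitness)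
open import Relation.Nullary.Irrelevant using (Irrelevant)
open import Relation.Nullary.Negation.Core using (¬_; contradiction; contradiction-irr)
open import Relation.Unary using (Pred; Decidable; _⊆_)

private
  variable
    k n q : ℕ

-- Irrelevance of `A` moves a witness over any proof of `A` to the one proof at which `B?` is run.
Σ-dec : ∀ {a b} {A : Set a} {B : A → Set b} →
        Irrelevant A → Dec A → Decidable B → Dec (Σ A B)
Σ-dec irr (no ¬a) B? = no (¬a ∘ proj₁)
Σ-dec irr (yes a) B? =
  map′ (a ,_) (λ (a′ , b) → subst _ (irr a′ a) b) (B? a)

toVec : Fin (q ^ k) → Vec (Fin q) k
toVec c = tabulate (finToFun c)

fromVec : Vec (Fin q) k → Fin (q ^ k)
fromVec v = funToFin (lookup v)

toVec-fromVec : (v : Vec (Fin q) k) → toVec (fromVec v) ≡ v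
toVec-fromVec v =
  trans (tabulate-cong (finToFun-funToFin (lookup v))) (tabulate∘lookup v)

anyVec? : ∀ {ℓ} {Q : Pred (Vec (Fin q) k) ℓ} → Decidable Q → Dec (∃ Q)
anyVec? {Q = Q} Q? =
  map′ (λ (c , p) → toVec c , p)
       (λ (v , p) → fromVec v , subst Q (sym (toVec-fromVec v)) p)
       (any? (Q? ∘ toVec))

distinct? : Decidable (Distinct {q} {k})
distinct? x =
  map′ (λ d {i} {j} → d i j) (λ d i j → d)
    (all? λ i → all? λ j → ¬? (i ≟ j) →-dec ¬? (lookup x i ≟ lookup x j))

anyΩ? : ∀ {ℓ} {Q : Pred (Ω k q) ℓ} → Decidable Q → Dec (∃ Q)
anyΩ? {k} {q} {Q = Q} Q? =
  map′ (λ (v , d , p) → (v , d) , p) (λ ((v , d) , p) → v , d , p) (anyVec? lift?)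
  where
  lift? : Decidable (λ v → ∃ λ d → Q (v , d))
  lift? v with distinct? v
  -- All inhabitants `d` of the irrelevance record are definitionally equal, so `proj₂` needs no
  -- transport.
  ... | yes d = map′ ([ d ] ,_) proj₂ (Q? (v , [ d ]))
  ... | no ¬d = no λ { ([ d ] , _) → contradiction-irr (λ {i} {j} → d {i} {j}) ¬d }

allΩ? : ∀ {ℓ} {Q : Pred (Ω k q) ℓ} → Decidable Q → Dec (∀ x → Q x)
allΩ? Q? =
  map′ (λ ∄ x → decidable-stable (Q? x) (λ ¬p → ∄ (x , ¬p)))
       (λ ∀Q (x , ¬p) → ¬p (∀Q x))
       (¬? (anyΩ? (¬? ∘ Q?)))

-- Spine functions for fixed page colours.
Guesses : ℕ → ℕ → Set
Guesses k q = Fin k → Vec (Fin q) (pred k) → Fin q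

Hits : Guesses k q → Fin k → Pred (Ω k q) _
Hits h i x = h i (π i x) ≡ lookup (value x) i

Covers : Guesses k q → Configuration k q → Set
Covers h P = ⟦ P ⟧ ⊆ λ x → ∃[ i ] Hits h i x

-- Reinserting coordinate `i` recovers the vector, and irrelevant distinctness proofs cannot tell
-- two elements apart.
Ω-ext : ∀ i {x y : Ω k q} → π i x ≡ π i y → lookup (value x) i ≡ lookup (value y) i → x ≡ y
Ω-ext {suc _} i {x} {y} x₋ᵢ≡y₋ᵢ xᵢ≡yᵢ = value-injective (begin
  value x                                          ≡⟨ insertAt-removeAt (value x) i ⟨
  insertAt (π i x) i (lookup (value x) i)          ≡⟨ cong₂ (λ v c → insertAt v i c) x₋ᵢ≡y₋ᵢ xᵢ≡yᵢ ⟩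
  insertAt (π i y) i (lookup (value y) i)          ≡⟨ insertAt-removeAt (value y) i ⟩
  value y                                          ∎)
  where open ≡-Reasoning

-- The guess `h i` sees only the projection, so two tuples hit over the same projection also share
-- coordinate `i`.
hits-saturated : (h : Guesses k q) → ∀ i {x y} →
                 Hits h i x → Hits h i y → π i x ≡ π i y → x ≡ y
hits-saturated h i hx hy eq =
  Ω-ext i eq (trans (sym hx) (trans (cong (h i) eq) hy))

-- Several spines may be right on one tuple; for the parts to be disjoint, each tuple goes only to
-- the index that `cov` selects.
covers⇒coverable : {P : Configuration k q} (h : Guesses k q) → Covers h P → Coverable P
covers⇒coverable {k} {q} {P} h cov =
  (λ i x → isYes (assigned? i x)) ,
  ((λ {x} p → proj₁ (cov p) , fromWitness {a? = assigned? _ x} (p , refl)) ,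
   (λ {x} (i , a) → proj₁ (toWitness {a? = assigned? i x} a))) ,
  (λ {i} {j} i≢j {x} (a , b) → i≢j (unique (toWitness {a? = assigned? i x} a)
                                           (toWitness {a? = assigned? j x} b))) ,
  λ i {x} {y} a b → hits-saturated h i (hit (toWitness {a? = assigned? i x} a))
                                       (hit (toWitness {a? = assigned? i y} b))
  where
  Assigned : Fin k → Pred (Ω k q) _
  Assigned i x = Σ (⟦ P ⟧ x) λ p → proj₁ (cov p) ≡ i

  assigned? : ∀ i → Decidable (Assigned i)
  assigned? i x = Σ-dec T-irrelevant (T? (P x)) (λ p → proj₁ (cov p) ≟ i)

  unique : ∀ {i j x} → Assigned i x → Assigned j x → i ≡ j
  -- The selected index could depend on the membership proof; irrelevance of `T` rules this out.
  unique (p , refl) (p′ , refl) = cong (proj₁ ∘ cov) (T-irrelevant p p′)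

  hit : ∀ {i x} → Assigned i x → Hits h i x
  hit (p , refl) = proj₂ (cov p)

-- Over each projection lies at most one tuple of part `i`; spine `i` guesses that tuple's
-- coordinate, and `default` if there is none.
coverable⇒covers : {P : Configuration k q} → Fin q → Coverable P → ∃[ h ] Covers h P
coverable⇒covers {k} {q} {P} default (part , (P⊆ , _) , _ , sat) = h , covers
  where
  h : Guesses k q
  h i y with anyΩ? (λ x → T? (part i x) ×-dec ≡-dec _≟_ (π i x) y)
  ... | yes (x , _) = lookup (value x) i
  ... | no _        = default

  hit : ∀ i {x} → ⟦ part i ⟧ x → Hits h i x
  hit i {x} x∈ with anyΩ? (λ x′ → T? (part i x′) ×-dec ≡-dec _≟_ (π i x′) (π i x))
  -- The search may return some `x′` other than `x` a priori; saturation identifies the two.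
  ... | yes (x′ , x′∈ , eq) = cong (λ w → lookup (value w) i) (sat i x′∈ x∈ eq)
  ... | no ∄                = contradiction (x , x∈ , refl) ∄

  covers : Covers h P
  covers p = let i , x∈ = P⊆ p in i , hit i x∈

-- For fixed page colours there are finitely many spine strategies; coding them by numbers makes an
-- exhaustive search possible.
toGuesses : Fin ((q ^ (q ^ pred k)) ^ k) → Guesses k q
toGuesses t i y = finToFun (finToFun t i) (fromVec y)

fromGuesses : Guesses k q → Fin ((q ^ (q ^ pred k)) ^ k)
fromGuesses h = funToFin (λ i → funToFin (λ c → h i (toVec c)))

-- Pointwise agreement suffices, since `Covers` depends only on the values of the guesses.
toGuesses-fromGuesses : (h : Guesses k q) → ∀ i y → toGuesses (fromGuesses h) i y ≡ h i y
toGuesses-fromGuesses h i y = begin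
  toGuesses (fromGuesses h) i y                             ≡⟨ cong (λ t → finToFun t (fromVec y)) (finToFun-funToFin _ i) ⟩
  finToFun (funToFin (λ c → h i (toVec c))) (fromVec y)     ≡⟨ finToFun-funToFin _ (fromVec y) ⟩
  h i (toVec (fromVec y))                                   ≡⟨ cong (h i) (toVec-fromVec y) ⟩
  h i y                                                     ∎
  where open ≡-Reasoning

covers? : (P : Configuration k q) → Dec (∃[ h ] Covers h P)
covers? P =
  map′ (λ (t , cov) → toGuesses t , λ {x} → cov x)
       (λ (h , cov) → fromGuesses h , λ x p →
         let i , hit = cov p in i , trans (toGuesses-fromGuesses h i _) hit)
       (any? λ t → allΩ? λ x →
         T? (P x) →-dec any? λ i → toGuesses t i (π i x) ≟ lookup (value x) i)

supp? : (P : Configuration k q) → Decidable (supp P)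
supp? P c = anyΩ? λ x → T? (P x) ×-dec any? λ i → lookup (value x) i ≟ c

image? : (g : PageFunction k q) (P : Configuration k q) → Decidable (image g P)
image? g P c = anyΩ? λ x → T? (P x) ×-dec (g x ≟ c)

pageGuards? : (g : PageFunction k q) (P : Configuration k q) → Dec (PageGuards g P)
pageGuards? g P =
  map′ (λ f {c} → f c) (λ f c → f) (all? λ c → ¬? (supp? P c) →-dec image? g P c)

guards? : (g : Fin n → PageFunction k q) (P : Configuration k q) → Dec (Guards g P)
guards? g P = any? λ j → pageGuards? (g j) P

¬pageGuards⇒colour : (g : PageFunction k q) (P : Configuration k q) →
                     ¬ PageGuards g P → ∃[ c ] ¬ supp P c × ¬ image g P c
¬pageGuards⇒colour {q = q} g P ¬pg
  with ¬∀⟶∃¬ q _ (λ c → ¬? (supp? P c) →-dec image? g P c) (λ f → ¬pg λ {c} → f c)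
... | c , ¬f = c , (λ s → ¬f λ ¬s → contradiction s ¬s) , (λ m → ¬f λ _ → m)

Unguessed : (Fin n → PageFunction k q) → Vec (Fin q) n → Pred (Ω k q) _
Unguessed g z x = Proper x z × (∀ j → g j x ≢ lookup z j)

unguessed? : (g : Fin n → PageFunction k q) (z : Vec (Fin q) n) → Decidable (Unguessed g z)
unguessed? g z x =
  (all? λ j → all? λ i → ¬? (lookup z j ≟ lookup (value x) i)) ×-dec
  (all? λ j → ¬? (g j x ≟ lookup z j))

-- Each page misses a colour of its own, and these independent choices form `z`: avoiding the
-- support makes it proper on all of `P`, avoiding the image makes every page err.
¬guards⇒unguessed : (g : Fin n → PageFunction k q) (P : Configuration k q) →
                    ¬ Guards g P → ∃[ z ] ⟦ P ⟧ ⊆ Unguessed g z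
¬guards⇒unguessed g P ¬guards = tabulate c , λ {x} p →
  (λ j i zⱼ≡xᵢ → proj₁ (avoids j) (x , p , i , trans (sym zⱼ≡xᵢ) (lookup∘tabulate c j))) ,
  (λ j gx≡zⱼ → proj₂ (avoids j) (x , p , trans gx≡zⱼ (lookup∘tabulate c j)))
  where
  colour : ∀ j → _
  colour j = ¬pageGuards⇒colour (g j) P λ pg → ¬guards (j , pg)
  c = proj₁ ∘ colour
  avoids = proj₂ ∘ colour

-- Properness puts `lookup z j` outside the support, so a guarding page `j` would guess it somewhere
-- on `P`.
unguessed⇒¬guards : (g : Fin n → PageFunction k q) (P : Configuration k q) {z : Vec (Fin q) n} →
                    ⟦ P ⟧ ⊆ Unguessed g z → ¬ Guards g P
unguessed⇒¬guards g P {z} P⊆ (j , pg)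
  with x , p , gx≡zⱼ ← pg {lookup z j} (λ (y , p , i , yᵢ≡zⱼ) → proj₁ (P⊆ p) j i (sym yᵢ≡zⱼ))
  = proj₂ (P⊆ p) j gx≡zⱼ

winning⇒guards : (g : Fin n → PageFunction k q) {h : Fin k → SpineFunction k n q} → Winning g h →
                 (P : Configuration k q) → ¬ Coverable P → Guards g P
winning⇒guards g {h} win P ¬cov = decidable-stable (guards? g P) λ ¬guards →
  let z , P⊆ = ¬guards⇒unguessed g P ¬guards
  -- With `z` fixed all pages err on `P`, so on each tuple of `P` some spine must be right.
  in ¬cov (covers⇒coverable (λ i y → h i y z) λ {x} p →
       case win x z (proj₁ (P⊆ p)) of λ where
         (inj₁ (j , gx≡zⱼ)) → contradiction gx≡zⱼ (proj₂ (P⊆ p) j)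
         (inj₂ hit)         → hit)

guards⇒winning : (g : Fin n → PageFunction k q) → Fin q →
                 ((P : Configuration k q) → ¬ Coverable P → Guards g P) →
                 ∃ λ (h : Fin k → SpineFunction k n q) → Winning g h
guards⇒winning {n} {k} {q} g default guards = (λ i y z → proj₁ (cover z) i y) , win
  where
  U : Vec (Fin q) n → Configuration k q
  U z x = isYes (unguessed? g z x)

  U⊆ : ∀ z → ⟦ U z ⟧ ⊆ Unguessed g z
  U⊆ z {x} = toWitness {a? = unguessed? g z x}

  cover : ∀ z → ∃[ h ] Covers h (U z)
  -- The hypothesis only refutes the absence of covering guesses; decidability by finite search
  -- turns this into actual ones.
  cover z = decidable-stable (covers? (U z)) λ ∄ →
    unguessed⇒¬guards g (U z) {z} (U⊆ z) (guards (U z) (∄ ∘ coverable⇒covers default))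

  win : Winning g (λ i y z → proj₁ (cover z) i y)
  win x z proper with any? (λ j → g j x ≟ lookup z j)
  ... | yes hit = inj₁ hit
  ... | no miss = inj₂ (proj₂ (cover z)
                    (fromWitness {a? = unguessed? g z x} (proper , λ j eq → miss (j , eq))))

theorem3p6 : ∀ (k n q : ℕ) .{{_ : NonZero k}} .{{_ : NonZero n}} .{{_ : NonZero q}} (g : Fin n → PageFunction k q) →
    (∃ λ (h : Fin k → SpineFunction k n q) → Winning g h) ⇔ (∀ (P : Configuration k q) → ¬ Coverable P → Guards g P)
theorem3p6 k n (suc _) g = mk⇔ (λ (h , win) → winning⇒guards g {h} win) (guards⇒winning g zero)
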